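{- Let $5 \le p \le q$, and suppose the complete tripartite graph $K(3,p,q)$ has a strong orientation with diameter two. Then $q \le \binom{p+1}{\lfloor \frac{p+1}{2} \rfloor} - 1$.
   Context: $K(3,p,q)$ is the complete tripartite graph with parts of sizes $3$, $p$, $q$. A strong orientation is an orientation of all edges making the digraph strongly connected; its diameter is the maximum, over ordered pairs of vertices $(u,v)$, of the length of a shortest directed path from $u$ to $v$. -}

module Defs where

open import Data.Nat using (ℕ; _≤_; _∸_; _/_; suc)
open import Data.Nat.Combinatorics using (_C_)
open import Data.Fin using (Fin)
open import Data.Sum using (_⊎_; inj₁; inj₂)
open import Data.Product using (_×_; ∃)
open import Data.Bool using (Bool; true; false)
open import Relation.Binary.PropositionalEquality using (_≡_)
open import Relation.Nullary using (¬_)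

Vtx : ℕ → ℕ → ℕ → Set
Vtx a b c = Fin a ⊎ (Fin b ⊎ Fin c)

part : ∀ {a b c} → Vtx a b c → Fin 3
part (inj₁ _)        = Fin.zero
part (inj₂ (inj₁ _)) = Fin.suc Fin.zero
part (inj₂ (inj₂ _)) = Fin.suc (Fin.suc Fin.zero)

Adj : ∀ {a b c} → Vtx a b c → Vtx a b c → Set
Adj u v = ¬ (part u ≡ part v)

record Orientation (a b c : ℕ) : Set where
  field
    arc      : Vtx a b c → Vtx a b c → Bool
    arc-adj  : ∀ u v → arc u v ≡ true → Adj u v
    one-dir  : ∀ u v → Adj u v → (arc u v ≡ true × arc v u ≡ false)
                                 ⊎ (arc u v ≡ false × arc v u ≡ true)
open Orientation public

Reach≤2 : ∀ {a b c} → Orientation a b c → Vtx a b c → Vtx a b c → Set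
Reach≤2 {a} {b} {c} o u v =
  u ≡ v ⊎ (arc o u v ≡ true ⊎ ∃ λ (w : Vtx a b c) → arc o u w ≡ true × arc o w v ≡ true)

-- The orientation is strongly connected with diameter (at most) two.
-- (Diameter ≤ 2 implies strong connectivity.)
StrongDiam2 : ∀ {a b c} → Orientation a b c → Set
StrongDiam2 o = ∀ u v → Reach≤2 o u v

{-# OPTIONS --safe #-}

-- Write x₁, x₂, x₃ for the part of size three, and let y and v range over the parts of sizes p
-- and q.  Record σ v = { i ∣ v → xᵢ }, τ v = { y ∣ v → y } and α y = { i ∣ xᵢ → y }.
-- Diameter two says that the sets σ v ∪ τ v form an antichain and that every pair (v, y) and
-- every pair (v, xᵢ) lies on a directed triangle v, xᵢ, y.  The triangles on (v, y) determine
-- τ v y from σ v unless σ v and α y agree both on some member and on some non-member, and the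
-- triangles on (v, xᵢ) determine τ v y as soon as y is the only candidate third vertex.
--
-- If all the α y agree off one coordinate i, then σ v is known off i, so that we have an
-- antichain in a set of p + 1 elements; the triangles on (v, xᵢ) make it miss a maximal chain.
-- A symmetric chain decomposition containing that chain gives q < C(p+1, ⌊(p+1)/2⌋).
--
-- Otherwise Sperner's theorem is applied to each of the eight classes σ v = S, on the set of
-- those y which S leaves free.  The sum of the eight bounds depends on α only through the
-- numbers of y with α y = A, and capping these at two keeps enough information.  In each of
-- the 3⁸ cases the sum is small enough for p = 5 and p = 6, and then for all larger p, since
-- C(n+2, ⌊(n+2)/2⌋) / C(n, ⌊n/2⌋) increases with n.

module Submission where

open import Defs
open import Data.Nat using (ℕ; _≤_; _∸_; _/_; _+_)
open import Data.Nat.Combinatorics using (_C_)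
open import Data.Product using (Σ)

open import Data.Bool as Bool using (Bool; true; false; not; _∧_; _∨_; _xor_; if_then_else_; f≤t; b≤b)
  renaming (_≤_ to _≤ᴮ_)
open import Data.Bool.Properties as Boolₚ
  using (∧-conicalˡ; ∧-conicalʳ; ∨-zeroʳ; not-injective; not-involutive; T-≡)
open import Data.Empty using (⊥-elim)
open import Data.Fin as Fin using (Fin; zero; suc; toℕ; _↑ˡ_; _↑ʳ_)
open import Data.Fin.Patterns using (0F; 1F; 2F; 3F)
open import Data.Fin.Properties using
  (toℕ-fromℕ<; injective⇒≤; ↑ˡ-injective; ↑ʳ-injective; splitAt-↑ˡ; splitAt-↑ʳ; toℕ-cast; toℕ-injective)
open import Data.Fin.Subset using (∣_∣)
open import Data.List as List using (List; []; _∷_; _++_; length; map; filter; allFin)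
open import Data.List.Membership.Propositional using (_∈_)
open import Data.List.Membership.Propositional.Properties using
  (∈-filter⁺; ∈-filter⁻; ∈-allFin; ∈-map⁺; ∈-++⁺ˡ; ∈-++⁺ʳ; ∈-lookup)
open import Data.List.Properties using (length-map; length-++; filter-all; length-tabulate)
open import Data.List.Relation.Unary.All as All using (All; []; _∷_)
open import Data.List.Relation.Unary.AllPairs using ([]; _∷_)
open import Data.List.Relation.Unary.Any using (here; there)
open import Data.List.Relation.Unary.Unique.Propositional using (Unique)
import Data.List.Relation.Unary.Unique.Propositional.Properties as Unique
open import Data.Maybe using (Maybe; just; nothing)
open import Data.Nat hiding (_/_)
open import Data.Nat.Combinatorics using (nCk+nC[k+1]≡[n+1]C[k+1]; nCk≡nC[n∸k]; nC1≡n)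
open import Data.Nat.DivMod using (+-distrib-/-∣ˡ)
open import Data.Nat.Divisibility using (∣-refl)
open import Data.Nat.ListAction using (sum)
open import Data.Nat.Properties
open import Data.Nat.Tactic.RingSolver using (solve-∀)
open import Data.Product using (∃; ∃₂; _×_; _,_; proj₂)
open import Data.Sum using (_⊎_; inj₁; inj₂)
open import Data.Sum.Properties using (inj₂-injective)
open import Data.Vec as Vec using (Vec; []; _∷_; lookup; fromList; replicate)
open import Data.Vec.Properties using (≡-dec; lookup∘tabulate)
open import Data.Vec.Relation.Binary.Pointwise.Inductive as Pointwise using (Pointwise; []; _∷_)
open import Data.Vec.Relation.Unary.All as VAll using ([]; _∷_)
open import Data.Vec.Relation.Unary.AllPairs using (AllPairs; []; _∷_)
open import Function using (_∘_; Equivalence)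
open import Relation.Binary.Definitions using (DecidableEquality)
open import Relation.Binary.PropositionalEquality
open import Relation.Nullary using (¬_; yes; no; contradiction; does)

private variable
  n l : ℕ
  X Y   : Set

-- Central binomial coefficients

middle : ℕ → ℕ
middle n = n C ⌊ n /2⌋

pascal : ∀ n k → suc n C suc k ≡ n C k + n C suc k
pascal n k = sym (nCk+nC[k+1]≡[n+1]C[k+1] n k)

-- Serves to compute the ratio of successive central coefficients. Pascal's rule splits the left
-- side, and the induction hypothesis applies at both `k` and `suc k`.
absorption : ∀ n k → suc k * (suc n C suc k) ≡ suc n * (n C k)
absorption zero    zero    = refl
absorption zero    (suc k) = *-zeroʳ k
absorption (suc n) zero    = trans (+-identityʳ _) (trans (nC1≡n (suc (suc n))) (sym (*-identityʳ _)))
absorption (suc n) (suc k) = begin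
  suc (suc k) * (suc (suc n) C suc (suc k))
    ≡⟨ cong (suc (suc k) *_) (pascal (suc n) (suc k)) ⟩
  suc (suc k) * (x + y)
    ≡⟨ rearrange k x y ⟩
  suc (suc k) * y + suc k * x + x
    ≡⟨ cong₂ (λ a b → a + b + x) (absorption n (suc k)) (absorption n k) ⟩
  suc n * (n C suc k) + suc n * (n C k) + x
    ≡⟨ cong (λ z → z + x) (sym (*-distribˡ-+ (suc n) (n C suc k) (n C k))) ⟩
  suc n * (n C suc k + n C k) + x
    ≡⟨ cong (λ z → suc n * z + x) (trans (+-comm (n C suc k) _) (sym (pascal n k))) ⟩
  suc n * x + x
    ≡⟨ +-comm _ x ⟩
  suc (suc n) * x ∎
  where
  open ≡-Reasoning
  x = suc n C suc k
  y = suc n C suc (suc k)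
  rearrange : ∀ k x y → suc (suc k) * (x + y) ≡ suc (suc k) * y + suc k * x + x
  rearrange = solve-∀

middle-even : ∀ k → middle (k + k) ≡ (k + k) C k
middle-even k = cong ((k + k) C_) (sym (n≡⌊n+n/2⌋ k))

middle-odd : ∀ k → middle (suc (k + k)) ≡ suc (k + k) C k
middle-odd k = cong (suc (k + k) C_) (sym (n≡⌈n+n/2⌉ k))

C-odd-sym : ∀ k → suc (k + k) C suc k ≡ suc (k + k) C k
C-odd-sym k = trans (nCk≡nC[n∸k] (s≤s (m≤m+n k k))) (cong (suc (k + k) C_) (m+n∸m≡n k k))

-- Pascal's rule splits the coefficient into two terms that are equal by symmetry.
middle-from-odd : ∀ k → middle (suc (suc (k + k))) ≡ 2 * middle (suc (k + k))
middle-from-odd k = begin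
  suc (suc (k + k)) C suc ⌊ k + k /2⌋ ≡⟨ cong (λ j → suc (suc (k + k)) C suc j) (sym (n≡⌊n+n/2⌋ k)) ⟩
  suc (suc (k + k)) C suc k           ≡⟨ pascal (suc (k + k)) k ⟩
  d + suc (k + k) C suc k             ≡⟨ cong (d +_) (C-odd-sym k) ⟩
  d + d                               ≡⟨ cong (d +_) (sym (+-identityʳ d)) ⟩
  2 * d                               ≡⟨ cong (2 *_) (sym (middle-odd k)) ⟩
  2 * middle (suc (k + k))            ∎
  where
  open ≡-Reasoning
  d = suc (k + k) C k

middle-from-even : ∀ k → suc k * middle (suc (k + k)) ≡ suc (k + k) * middle (k + k)
middle-from-even k = begin
  suc k * middle (suc (k + k)) ≡⟨ cong (suc k *_) (trans (middle-odd k) (sym (C-odd-sym k))) ⟩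
  suc k * (suc (k + k) C suc k) ≡⟨ absorption (k + k) k ⟩
  suc (k + k) * ((k + k) C k) ≡⟨ cong (suc (k + k) *_) (sym (middle-even k)) ⟩
  suc (k + k) * middle (k + k) ∎
  where open ≡-Reasoning

even⊎odd : ∀ n → (∃ λ k → n ≡ k + k) ⊎ (∃ λ k → n ≡ suc (k + k))
even⊎odd zero = inj₁ (0 , refl)
even⊎odd (suc n) with even⊎odd n
... | inj₁ (k , eq) = inj₂ (k , cong suc eq)
... | inj₂ (k , eq) = inj₁ (suc k , trans (cong suc eq) (cong suc (sym (+-suc k k))))

+-suc² : ∀ k → suc k + suc k ≡ suc (suc (k + k))
+-suc² k = cong suc (+-suc k k)

-- Read as `middle (1 + n) / middle n ≤ middle (3 + n) / middle (2 + n)`. For n = 2k these ratios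
-- are (2k+1)/(k+1) and (2k+3)/(k+2); for odd n both equal 2.
middle-ratio : ∀ n → middle (suc n) * middle (2 + n) ≤ middle (3 + n) * middle n
middle-ratio n with even⊎odd n
... | inj₁ (k , refl) = *-cancelˡ-≤ (suc k * suc (suc k)) (begin
    suc k * suc (suc k) * (d * c′)           ≡⟨ shuffle₁ k d c′ ⟩
    suc (suc k) * (suc k * d) * c′           ≡⟨ cong (λ z → suc (suc k) * z * c′) (middle-from-even k) ⟩
    -- The added term is the exact difference, as (2k+3)(k+1) = (2k+1)(k+2) + 1.
    suc (suc k) * (suc (k + k) * c) * c′     ≤⟨ m≤m+n _ (c * c′) ⟩
    suc (suc k) * (suc (k + k) * c) * c′ + c * c′ ≡⟨ shuffle₂ k c c′ ⟩
    suc k * (suc (suc k + suc k) * c′) * c   ≡⟨ cong (λ z → suc k * z * c) (sym even′) ⟩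
    suc k * (suc (suc k) * d′) * c           ≡⟨ shuffle₃ k d′ c ⟩
    suc k * suc (suc k) * (d′ * c)           ∎)
  where
  open ≤-Reasoning
  c  = middle (k + k)
  d  = middle (suc (k + k))
  c′ = middle (2 + (k + k))
  d′ = middle (3 + (k + k))
  even′ : suc (suc k) * d′ ≡ suc (suc k + suc k) * c′
  even′ = subst (λ z → suc (suc k) * middle (suc z) ≡ suc (suc k + suc k) * middle z)
                (+-suc² k) (middle-from-even (suc k))
  shuffle₁ : ∀ k d c → suc k * suc (suc k) * (d * c) ≡ suc (suc k) * (suc k * d) * c
  shuffle₁ = solve-∀
  shuffle₂ : ∀ k c e → suc (suc k) * (suc (k + k) * c) * e + c * e
                     ≡ suc k * (suc (suc k + suc k) * e) * c
  shuffle₂ = solve-∀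
  shuffle₃ : ∀ k d c → suc k * (suc (suc k) * d) * c ≡ suc k * suc (suc k) * (d * c)
  shuffle₃ = solve-∀
... | inj₂ (k , refl) = ≤-reflexive (begin
    c * d′       ≡⟨ cong (_* d′) (middle-from-odd k) ⟩
    2 * d * d′   ≡⟨ shuffle d d′ ⟩
    2 * d′ * d   ≡⟨ cong (_* d) (sym odd′) ⟩
    c′ * d       ∎)
  where
  open ≡-Reasoning
  d  = middle (suc (k + k))
  c  = middle (2 + (k + k))
  d′ = middle (3 + (k + k))
  c′ = middle (4 + (k + k))
  odd′ : c′ ≡ 2 * d′
  odd′ = subst (λ z → middle (suc (suc z)) ≡ 2 * middle (suc z)) (+-suc² k) (middle-from-odd (suc k))
  shuffle : ∀ a b → 2 * a * b ≡ 2 * b * a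
  shuffle = solve-∀

middle-step : ∀ n → middle n ≤ middle (suc n)
middle-step n with even⊎odd n
... | inj₁ (zero  , refl) = ≤-refl
... | inj₁ (suc k , refl) = begin
  middle (suc k + suc k)  ≡⟨ middle-even (suc k) ⟩
  (suc k + suc k) C suc k ≤⟨ m≤n+m _ _ ⟩
  (suc k + suc k) C k + (suc k + suc k) C suc k ≡⟨ sym (pascal (suc k + suc k) k) ⟩
  suc (suc k + suc k) C suc k ≡⟨ sym (middle-odd (suc k)) ⟩
  middle (suc (suc k + suc k)) ∎
  where open ≤-Reasoning
... | inj₂ (k , refl) = ≤-trans (m≤m+n _ _) (≤-reflexive (sym (middle-from-odd k)))

middle-mono : ∀ {m n} → m ≤ n → middle m ≤ middle n
middle-mono {m} {n} m≤n with ≤⇒≤′ m≤n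
... | ≤′-refl = ≤-refl
... | ≤′-step {k} m≤′n = ≤-trans (middle-mono (≤′⇒≤ m≤′n)) (middle-step k)

middle>0 : ∀ n → 0 < middle n
middle>0 n = middle-mono (z≤n {n})

-- Iterating `middle-ratio` shows that the growth factor over two steps never decreases; the common
-- factor `middle n′` cancels.
middle-growth : ∀ {m n} → m ≤ n → middle (2 + m) * middle n ≤ middle (2 + n) * middle m
middle-growth {m} {n} m≤n with ≤⇒≤′ m≤n
... | ≤′-refl = ≤-refl
... | ≤′-step {n′} m≤′n = *-cancelˡ-≤ (middle n′) ⦃ >-nonZero (middle>0 n′) ⦄ (begin
  middle n′ * (middle (2 + m) * middle (suc n′)) ≡⟨ shuffle₁ (middle n′) (middle (2 + m)) (middle (suc n′)) ⟩
  middle (2 + m) * middle n′ * middle (suc n′)   ≤⟨ *-monoˡ-≤ (middle (suc n′)) (middle-growth (≤′⇒≤ m≤′n)) ⟩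
  middle (2 + n′) * middle m * middle (suc n′)   ≡⟨ shuffle₂ (middle (2 + n′)) (middle m) (middle (suc n′)) ⟩
  middle (suc n′) * middle (2 + n′) * middle m   ≤⟨ *-monoˡ-≤ (middle m) (middle-ratio n′) ⟩
  middle (3 + n′) * middle n′ * middle m         ≡⟨ shuffle₃ (middle (3 + n′)) (middle n′) (middle m) ⟩
  middle n′ * (middle (3 + n′) * middle m)       ∎)
  where
  open ≤-Reasoning
  shuffle₁ : ∀ a b c → a * (b * c) ≡ b * a * c
  shuffle₁ = solve-∀
  shuffle₂ : ∀ a b c → a * b * c ≡ c * a * b
  shuffle₂ = solve-∀
  shuffle₃ : ∀ a b c → a * b * c ≡ b * (a * c)
  shuffle₃ = solve-∀

-- Sperner's theorem

-- Chain n l enumerates the chains with l + 1 members in a symmetric chain decomposition of the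
-- subsets of an n-element set.  A chain c₀ ⊃ … ⊃ cₗ gives c₀+z ⊃ c₀ ⊃ … ⊃ cₗ (up) and, if l > 0,
-- c₁+z ⊃ … ⊃ cₗ+z (down).  Positions count from the top.
data Chain : ℕ → ℕ → Set where
  []   : Chain 0 0
  up   : Chain n l → Chain (suc n) (suc l)
  down : Chain n (suc l) → Chain (suc n) l

member : Chain n l → Fin (suc l) → Vec Bool n
member []       _       = []
member (up c)   zero    = true ∷ member c zero
member (up c)   (suc j) = false ∷ member c j
member (down c) j       = true ∷ member c (suc j)

Position : ℕ → Set
Position n = ∃ λ l → Chain n l × Fin (suc l)

-- Inverse to `member`, so each subset lies on exactly one chain. When the new element is present,
-- the top of the old chain goes to `up` and every other member to `down`, one place higher.
position : Vec Bool n → Position n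
position [] = 0 , [] , zero
position (true ∷ v) with position v
... | l , c , zero  = suc l , up c , zero
... | suc l , c , suc j = l , down c , j
position (false ∷ v) with position v
... | l , c , j = suc l , up c , suc j

member-position : (v : Vec Bool n) → let (l , c , j) = position v in member c j ≡ v
member-position [] = refl
member-position (true ∷ v) with position v | member-position v
... | l , c , zero | eq = cong (true ∷_) eq
... | suc l , c , suc j | eq = cong (true ∷_) eq
member-position (false ∷ v) with position v | member-position v
... | l , c , j | eq = cong (false ∷_) eq

position-member : (c : Chain n l) (j : Fin (suc l)) → position (member c j) ≡ (l , c , j)
position-member [] zero = refl
position-member (up c) zero rewrite position-member c zero = refl
position-member (up c) (suc j) rewrite position-member c j = refl
position-member (down c) j rewrite position-member c (suc j) = refl

_⊑_ : Vec Bool n → Vec Bool n → Set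
_⊑_ = Pointwise _≤ᴮ_

⊑-refl : {v : Vec Bool n} → v ⊑ v
⊑-refl = Pointwise.refl b≤b

member-antitone : (c : Chain n l) {i j : Fin (suc l)} → i Fin.≤ j → member c j ⊑ member c i
member-antitone []       _                                = []
member-antitone (up c) {zero} {zero} _                    = ⊑-refl
member-antitone (up c) {zero} {suc j} _                   = f≤t ∷ member-antitone c z≤n
member-antitone (up c) {suc i} {suc j} (s≤s i≤j)          = b≤b ∷ member-antitone c i≤j
member-antitone (down c) i≤j                              = b≤b ∷ member-antitone c (s≤s i≤j)

-- Symmetry of the chains: sizes run from (n + l)/2 down to (n - l)/2. Doubling avoids the division.
member-size : (c : Chain n l) (j : Fin (suc l)) →
  (∣ member c j ∣ + toℕ j) + (∣ member c j ∣ + toℕ j) ≡ n + l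
member-size [] zero = refl
member-size {suc n} {suc l} (up c) zero =
  trans (+-suc² (∣ member c zero ∣ + 0)) (trans (cong (2 +_) (member-size c zero)) (cong suc (sym (+-suc n l))))
member-size {suc n} {suc l} (up c) (suc j) =
  trans (cong (λ z → z + z) (+-suc ∣ member c j ∣ (toℕ j)))
  (trans (+-suc² (∣ member c j ∣ + toℕ j)) (trans (cong (2 +_) (member-size c j)) (cong suc (sym (+-suc n l)))))
member-size {suc n} {l} (down c) j =
  trans (cong (λ z → z + z) (sym (+-suc ∣ member c (suc j) ∣ (toℕ j))))
  (trans (member-size c (suc j)) (+-suc n l))

-- Positions count from the top, so rounding l/2 up gives the member of size ⌊n/2⌋ for either parity
-- of n.
centre : Chain n l → Vec Bool n
centre {l = l} c = member c (Fin.fromℕ< (s≤s (⌈n/2⌉≤n l)))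

centre-size : (c : Chain n l) → ∣ centre c ∣ ≡ ⌊ n /2⌋
centre-size {n} {l} c = half ∣ centre c ∣ ⌊ l /2⌋ (⌈n/2⌉-cases l)
  (trans (cong (λ z → (w + z) + (w + z)) (sym (toℕ-fromℕ< (s≤s (⌈n/2⌉≤n l)))))
  (trans (member-size c _) (cong (n +_) (sym (⌊n/2⌋+⌈n/2⌉≡n l)))))
  where
  w = ∣ centre c ∣
  ⌈n/2⌉-cases : ∀ l → ⌈ l /2⌉ ≡ ⌊ l /2⌋ ⊎ ⌈ l /2⌉ ≡ suc ⌊ l /2⌋
  ⌈n/2⌉-cases zero = inj₁ refl
  ⌈n/2⌉-cases (suc zero) = inj₂ refl
  ⌈n/2⌉-cases (suc (suc l)) with ⌈n/2⌉-cases l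
  ... | inj₁ eq = inj₁ (cong suc eq)
  ... | inj₂ eq = inj₂ (cong suc eq)
  shuffle₁ : ∀ w x → (w + x) + (w + x) ≡ (w + w) + (x + x)
  shuffle₁ = solve-∀
  shuffle₂ : ∀ w x → (w + suc x) + (w + suc x) ≡ suc (w + w) + (x + suc x)
  shuffle₂ = solve-∀
  half : ∀ w x {y} → y ≡ x ⊎ y ≡ suc x → (w + y) + (w + y) ≡ n + (x + y) → w ≡ ⌊ n /2⌋
  half w x (inj₁ refl) eq = trans (n≡⌊n+n/2⌋ w)
    (cong ⌊_/2⌋ (+-cancelʳ-≡ (x + x) (w + w) n (trans (sym (shuffle₁ w x)) eq)))
  half w x (inj₂ refl) eq = trans (n≡⌈n+n/2⌉ w)
    (cong ⌊_/2⌋ (+-cancelʳ-≡ (x + suc x) (suc (w + w)) n (trans (sym (shuffle₂ w x)) eq)))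

∣v∣≡0⇒v≡⊥ : (v : Vec Bool n) → ∣ v ∣ ≡ 0 → v ≡ replicate n false
∣v∣≡0⇒v≡⊥ [] _ = refl
∣v∣≡0⇒v≡⊥ (false ∷ v) eq = cong (false ∷_) (∣v∣≡0⇒v≡⊥ v eq)

-- Pascal's rule as a numbering: the sets with the first element come before those without it.
rank : ∀ k (v : Vec Bool n) → ∣ v ∣ ≡ k → Fin (n C k)
rank zero v _ = zero
rank {suc n} (suc k) (true ∷ v) eq =
  Fin.cast (sym (pascal n k)) (rank k v (suc-injective eq) ↑ˡ (n C suc k))
rank {suc n} (suc k) (false ∷ v) eq =
  Fin.cast (sym (pascal n k)) ((n C k) ↑ʳ rank (suc k) v eq)

cast-injective : ∀ {m n} .(eq : m ≡ n) {i j : Fin m} → Fin.cast eq i ≡ Fin.cast eq j → i ≡ j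
cast-injective eq {i} {j} p = toℕ-injective
  (trans (sym (toℕ-cast eq i)) (trans (cong toℕ p) (toℕ-cast eq j)))

↑ˡ≢↑ʳ : ∀ {m n} (i : Fin m) (j : Fin n) → i ↑ˡ n ≢ m ↑ʳ j
↑ˡ≢↑ʳ {m} {n} i j eq = contradiction
  (trans (sym (splitAt-↑ˡ m i n)) (trans (cong (Fin.splitAt m) eq) (splitAt-↑ʳ m n j))) λ ()

rank-injective : ∀ k (u v : Vec Bool n) (p : ∣ u ∣ ≡ k) (r : ∣ v ∣ ≡ k) → rank k u p ≡ rank k v r → u ≡ v
rank-injective zero u v p r _ = trans (∣v∣≡0⇒v≡⊥ u p) (sym (∣v∣≡0⇒v≡⊥ v r))
rank-injective {suc n} (suc k) (true ∷ u) (true ∷ v) p r eq =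
  cong (true ∷_) (rank-injective k u v _ _ (↑ˡ-injective (n C suc k) _ _ (cast-injective (sym (pascal n k)) eq)))
rank-injective {suc n} (suc k) (true ∷ u) (false ∷ v) p r eq =
  ⊥-elim (↑ˡ≢↑ʳ (rank k u (suc-injective p)) (rank (suc k) v r) (cast-injective (sym (pascal n k)) eq))
rank-injective {suc n} (suc k) (false ∷ u) (true ∷ v) p r eq =
  ⊥-elim (↑ˡ≢↑ʳ (rank k v (suc-injective r)) (rank (suc k) u p) (cast-injective (sym (pascal n k)) (sym eq)))
rank-injective {suc n} (suc k) (false ∷ u) (false ∷ v) p r eq =
  cong (false ∷_) (rank-injective (suc k) u v _ _ (↑ʳ-injective (n C k) _ _ (cast-injective (sym (pascal n k)) eq)))

code : Vec Bool n → Fin (middle n)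
code {n} v = let (l , c , j) = position v in rank ⌊ n /2⌋ (centre c) (centre-size c)

-- Equal codes force equal centres, and `position` recovers the chain from its centre.
code-chain : (u v : Vec Bool n) → code u ≡ code v →
  ∃₂ λ l (c : Chain n l) → (∃ λ i → member c i ≡ u) × (∃ λ j → member c j ≡ v)
code-chain {n} u v eq with position u | member-position u | position v | member-position v
... | l , c , i | p | m , d , j | r
  with trans (sym (position-member c _))
       (trans (cong position (rank-injective ⌊ n /2⌋ (centre c) (centre d) (centre-size c) (centre-size d) eq))
              (position-member d _))
... | refl = l , c , (i , p) , (j , r)

code-comparable : (u v : Vec Bool n) → code u ≡ code v → u ⊑ v ⊎ v ⊑ u
code-comparable u v eq with code-chain u v eq
... | l , c , (i , refl) , (j , refl) with ≤-total (toℕ i) (toℕ j)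
... | inj₁ i≤j = inj₂ (member-antitone c i≤j)
... | inj₂ j≤i = inj₁ (member-antitone c j≤i)

-- The vectors false ... false true ... true. They form a maximal chain, which depends on the order
-- of the coordinates.
Staircase : Vec Bool n → Set
Staircase = AllPairs _≤ᴮ_

false≤all : (v : Vec Bool n) → VAll.All (false ≤ᴮ_) v
false≤all []          = []
false≤all (false ∷ v) = b≤b ∷ false≤all v
false≤all (true ∷ v)  = f≤t ∷ false≤all v

-- The chain of the decomposition that runs from the full set to the empty set.
ups : ∀ n → Chain n n
ups zero    = []
ups (suc n) = up (ups n)

member-ups-top : ∀ n → member (ups n) zero ≡ replicate n true
member-ups-top zero    = refl
member-ups-top (suc n) = cong (true ∷_) (member-ups-top n)

replicate-staircase : ∀ n → Staircase (replicate n true)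
replicate-staircase zero    = []
replicate-staircase (suc n) = true≤replicate n ∷ replicate-staircase n
  where
  true≤replicate : ∀ n → VAll.All (true ≤ᴮ_) (replicate n true)
  true≤replicate zero    = []
  true≤replicate (suc n) = b≤b ∷ true≤replicate n

ups-staircase : ∀ n (j : Fin (suc n)) → Staircase (member (ups n) j)
ups-staircase n       zero    = subst Staircase (sym (member-ups-top n)) (replicate-staircase n)
ups-staircase (suc n) (suc j) = false≤all _ ∷ ups-staircase n j

code-top⇒staircase : (v : Vec Bool n) → code (replicate n true) ≡ code v → Staircase v
code-top⇒staircase {n} v eq with code-chain (replicate n true) v eq
... | l , c , (i , p) , (j , refl)
  with trans (sym (position-member c i)) (trans (cong position (trans p (sym (member-ups-top n)))) (position-member (ups n) zero))
... | refl = ups-staircase n j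

-- Members of one chain are comparable, so `code` is injective on an antichain.
sperner : ∀ {r} (F : Fin r → Vec Bool n) → (∀ a b → a ≢ b → ¬ F a ⊑ F b) → r ≤ middle n
sperner {n} {r} F antichain = injective⇒≤ {f = λ a → code (F a)} injective
  where
  injective : ∀ {a b} → code (F a) ≡ code (F b) → a ≡ b
  injective {a} {b} eq with a Fin.≟ b | code-comparable (F a) (F b) eq
  ... | yes a≡b | _      = a≡b
  ... | no  a≢b | inj₁ p = contradiction p (antichain a b a≢b)
  ... | no  a≢b | inj₂ p = contradiction p (antichain b a (≢-sym a≢b))

-- The code of the chain `ups n` is taken by no `F a`, so it can be added as one more value without
-- losing injectivity.
sperner-strict : ∀ {r} (F : Fin r → Vec Bool n) → (∀ a b → a ≢ b → ¬ F a ⊑ F b) →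
  (∀ a → ¬ Staircase (F a)) → r < middle n
sperner-strict {n} {r} F antichain avoids = injective⇒≤ {f = G} injective
  where
  G : Fin (suc r) → Fin (middle n)
  G zero    = code (replicate n true)
  G (suc a) = code (F a)
  injective : ∀ {a b} → G a ≡ G b → a ≡ b
  injective {zero}  {zero}  _  = refl
  injective {zero}  {suc b} eq = contradiction (code-top⇒staircase (F b) eq) (avoids b)
  injective {suc a} {zero}  eq = contradiction (code-top⇒staircase (F a) (sym eq)) (avoids a)
  injective {suc a} {suc b} eq with a Fin.≟ b | code-comparable (F a) (F b) eq
  ... | yes a≡b | _      = cong suc a≡b
  ... | no  a≢b | inj₁ p = contradiction p (antichain a b a≢b)
  ... | no  a≢b | inj₂ p = contradiction p (antichain b a (≢-sym a≢b))

-- Indexed by a list rather than a subset of `Y`, since the order of the entries decides which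
-- vectors are staircases.
restrict : (Y → Bool) → (ys : List Y) → Vec Bool (length ys)
restrict g ys = Vec.map g (fromList ys)

restrict-⊑⁻ : ∀ {g h : Y → Bool} (ys : List Y) → restrict g ys ⊑ restrict h ys → ∀ {y} → y ∈ ys → g y ≤ᴮ h y
restrict-⊑⁻ (_ ∷ ys) (p ∷ ps) (here refl) = p
restrict-⊑⁻ (_ ∷ ys) (p ∷ ps) (there y∈)  = restrict-⊑⁻ ys ps y∈

restrict-All⁻ : ∀ {P : Bool → Set} {g : Y → Bool} (ys : List Y) →
  VAll.All P (restrict g ys) → ∀ {y} → y ∈ ys → P (g y)
restrict-All⁻ (_ ∷ ys) (p ∷ ps) (here refl) = p
restrict-All⁻ (_ ∷ ys) (p ∷ ps) (there y∈)  = restrict-All⁻ ys ps y∈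

staircase-before : ∀ {g : Y → Bool} (xs : List Y) {z zs} → Staircase (restrict g (xs ++ z ∷ zs)) →
  ∀ {x} → x ∈ xs → g x ≤ᴮ g z
staircase-before (_ ∷ xs) (p ∷ _)  (here refl) = restrict-All⁻ (xs ++ _) p (∈-++⁺ʳ xs (here refl))
staircase-before (_ ∷ xs) (_ ∷ ps) (there x∈)  = staircase-before xs ps x∈

staircase-after : ∀ {g : Y → Bool} (xs : List Y) {z zs} → Staircase (restrict g (xs ++ z ∷ zs)) →
  ∀ {y} → y ∈ zs → g z ≤ᴮ g y
staircase-after []       (p ∷ _)  y∈ = restrict-All⁻ _ p y∈
staircase-after (_ ∷ xs) (_ ∷ ps) y∈ = staircase-after xs ps y∈

lookup-unique : ∀ {xs : List X} → Unique xs → ∀ {i j} → i ≢ j → List.lookup xs i ≢ List.lookup xs j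
lookup-unique (_  ∷ _) {zero}  {zero}  i≢j = contradiction refl i≢j
lookup-unique (x∉ ∷ _) {zero}  {suc j} _   = All.lookup x∉ (∈-lookup j)
lookup-unique (x∉ ∷ _) {suc i} {zero}  _   = ≢-sym (All.lookup x∉ (∈-lookup i))
lookup-unique (_  ∷ u) {suc i} {suc j} i≢j = lookup-unique u (i≢j ∘ cong suc)

sperner-list : (vs : List X) → Unique vs → (ys : List Y) (g : X → Y → Bool) →
  (∀ {u v} → u ∈ vs → v ∈ vs → u ≢ v → ¬ (∀ {y} → y ∈ ys → g u y ≤ᴮ g v y)) →
  length vs ≤ middle (length ys)
sperner-list vs unique ys g antichain = sperner (λ a → restrict (g (List.lookup vs a)) ys)
  λ a b a≢b p → antichain (∈-lookup a) (∈-lookup b) (lookup-unique unique a≢b) (restrict-⊑⁻ ys p)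

-- Case distinction on the multiplicities of the values of α

Side : Set
Side = Vec Bool 3

sides : List Side
sides = (false ∷ false ∷ false ∷ []) ∷ (false ∷ false ∷ true ∷ [])
      ∷ (false ∷ true  ∷ false ∷ []) ∷ (false ∷ true  ∷ true ∷ [])
      ∷ (true  ∷ false ∷ false ∷ []) ∷ (true  ∷ false ∷ true ∷ [])
      ∷ (true  ∷ true  ∷ false ∷ []) ∷ (true  ∷ true  ∷ true ∷ []) ∷ []

⟦_⟧ : Bool → ℕ
⟦ false ⟧ = 0
⟦ true ⟧  = 1

total : (Side → ℕ) → (Side → Bool) → ℕ
total w P = sum (map (λ A → w A * ⟦ P A ⟧) sides)

some : (Fin 3 → Bool) → Bool
some f = f 0F ∨ f 1F ∨ f 2F

some⁺ : ∀ f i → f i ≡ true → some f ≡ true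
some⁺ f 0F eq rewrite eq = refl
some⁺ f 1F eq rewrite eq = ∨-zeroʳ (f 0F)
some⁺ f 2F eq rewrite eq | ∨-zeroʳ (f 1F) = ∨-zeroʳ (f 0F)

∨-true⁻ : ∀ a {b} → a ∨ b ≡ true → a ≡ true ⊎ b ≡ true
∨-true⁻ true  _  = inj₁ refl
∨-true⁻ false eq = inj₂ eq

some⁻ : ∀ f → some f ≡ true → ∃ λ i → f i ≡ true
some⁻ f eq with ∨-true⁻ (f 0F) eq
... | inj₁ e₀ = 0F , e₀
... | inj₂ eq′ with ∨-true⁻ (f 1F) eq′
... | inj₁ e₁ = 1F , e₁
... | inj₂ e₂ = 2F , e₂

agree : Bool → Bool → Bool
agree a b = not (a xor b)

agree⁺ : ∀ {a b} → a ≡ b → agree a b ≡ true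
agree⁺ {true}  refl = refl
agree⁺ {false} refl = refl

agreeAt : Fin 3 → Side → Side → Bool
agreeAt i S A = agree (lookup S i) (lookup A i)

-- Complementary sets admit no directed triangle on (v, y).
opposite : Side → Side → Bool
opposite S A = not (some λ i → agreeAt i S A)

-- Here triangles of both orientations are possible on (v, y), so they leave `τ v y` undetermined.
mixed : Side → Side → Bool
mixed S A = some (λ i → lookup S i ∧ lookup A i) ∧ some (λ i → not (lookup S i) ∧ not (lookup A i))

-- Upper bounds for the number of v with σ v = S: slack k means that σ v = S
-- determines τ v on at least k of the y, and single that it leaves τ v free on at most one y.
data Bound : Set where
  none   : Bound
  single : Bound
  slack  : Fin 4 → Bound

cap : ℕ → Fin 4
cap 0 = 0F
cap 1 = 1F
cap 2 = 2F
cap _ = 3F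

module _ (ℓ : Side → ℕ) where

  -- The number of possible third vertices y of a directed triangle on (v, xᵢ), when σ v = S.
  candidates : Side → Vec ℕ 3
  candidates S = Vec.tabulate λ i → total ℓ (agreeAt i S)

  -- The argument cs will be candidates S; it is abstracted so that evaluation shares it.
  module _ (S : Side) (cs : Vec ℕ 3) where

    -- A unique candidate for the third vertex on (v, xᵢ) must form that triangle, which fixes
    -- `τ v y`.
    pinned : Side → Bool
    pinned A = some λ i → (lookup cs i ≡ᵇ 1) ∧ agreeAt i S A

    free : Side → Bool
    free A = mixed S A ∧ not (pinned A)

    -- Without a candidate for some xᵢ the class is empty. With at most one free y, Sperner's bound
    -- is 1 whatever p is, whereas `slack` would give a value growing with p.
    boundFrom : Bound
    boundFrom = if some (λ i → lookup cs i ≡ᵇ 0) then none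
           else if total ℓ free ≤ᵇ 1 then single
           else slack (cap (total ℓ λ A → not (free A)))

  bound : Side → Bound
  bound S = if total ℓ (opposite S) ≡ᵇ 0 then boundFrom S (candidates S) else none

  constant : Fin 3 → Bool
  constant i = (total ℓ (λ A → lookup A i) ≡ᵇ 0) ∨ (total ℓ (λ A → not (lookup A i)) ≡ᵇ 0)

  -- The case of `strict-bound`: two constant coordinates mean that all `α y` agree off the third.
  special : Bool
  special = (constant 0F ∧ constant 1F) ∨ (constant 0F ∧ constant 2F) ∨ (constant 1F ∧ constant 2F)

value : Vec ℕ 4 → Bound → ℕ
value w none      = 0
value w single    = 1
value w (slack k) = lookup w k

capacity : Vec ℕ 4 → List Bound → ℕ
capacity w bs = sum (map (value w) bs)

-- The numbers are middle 5, …, middle 2 against middle 6, and middle 6, …, middle 3 against middle 7.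
small : List Bound → Bool
small bs = (capacity (10 ∷ 6 ∷ 3 ∷ 2 ∷ []) bs <ᵇ 20) ∧ (capacity (20 ∷ 10 ∷ 6 ∷ 3 ∷ []) bs <ᵇ 35)

acceptable : (Side → ℕ) → Bool
acceptable ℓ = special ℓ ∨ small (map (bound ℓ) sides)

-- Functions on the eight sides are given by vectors, in the order of `sides`, so that they can be
-- enumerated.
table : Vec ℕ 8 → Side → ℕ
table (a ∷ b ∷ c ∷ d ∷ e ∷ f ∷ g ∷ h ∷ []) (false ∷ false ∷ false ∷ []) = a
table (a ∷ b ∷ c ∷ d ∷ e ∷ f ∷ g ∷ h ∷ []) (false ∷ false ∷ true ∷ [])  = b
table (a ∷ b ∷ c ∷ d ∷ e ∷ f ∷ g ∷ h ∷ []) (false ∷ true ∷ false ∷ [])  = c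
table (a ∷ b ∷ c ∷ d ∷ e ∷ f ∷ g ∷ h ∷ []) (false ∷ true ∷ true ∷ [])   = d
table (a ∷ b ∷ c ∷ d ∷ e ∷ f ∷ g ∷ h ∷ []) (true ∷ false ∷ false ∷ [])  = e
table (a ∷ b ∷ c ∷ d ∷ e ∷ f ∷ g ∷ h ∷ []) (true ∷ false ∷ true ∷ [])   = f
table (a ∷ b ∷ c ∷ d ∷ e ∷ f ∷ g ∷ h ∷ []) (true ∷ true ∷ false ∷ [])   = g
table (a ∷ b ∷ c ∷ d ∷ e ∷ f ∷ g ∷ h ∷ []) (true ∷ true ∷ true ∷ [])    = h

forall≤2 : ∀ n → (Vec ℕ n → Bool) → Bool
forall≤2 zero    f = f []
forall≤2 (suc n) f = forall≤2 n (λ v → f (0 ∷ v)) ∧ forall≤2 n (λ v → f (1 ∷ v)) ∧ forall≤2 n (λ v → f (2 ∷ v))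

forall≤2⁻ : (f : Vec ℕ n → Bool) → forall≤2 n f ≡ true → (v : Vec ℕ n) → VAll.All (_≤ 2) v → f v ≡ true
forall≤2⁻ f eq []      _       = eq
forall≤2⁻ {suc n} f eq (a ∷ v) (a≤2 ∷ v≤2) = at a≤2
  where
  branch : ℕ → Bool
  branch a = forall≤2 n (λ v → f (a ∷ v))
  at : ∀ {a} → a ≤ 2 → f (a ∷ v) ≡ true
  at {0} _ = forall≤2⁻ _ (∧-conicalˡ (branch 0) _ eq) v v≤2
  at {1} _ = forall≤2⁻ _ (∧-conicalˡ (branch 1) (branch 2) (∧-conicalʳ (branch 0) _ eq)) v v≤2
  at {2} _ = forall≤2⁻ _ (∧-conicalʳ (branch 1) (branch 2) (∧-conicalʳ (branch 0) _ eq)) v v≤2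
  at {suc (suc (suc _))} (s≤s (s≤s ()))

-- From p = 5 and p = 6 to all larger p

margins : ℕ → Vec ℕ 4
margins p = middle p ∷ middle (p ∸ 1) ∷ middle (p ∸ 2) ∷ middle (p ∸ 3) ∷ []

Fits : List Bound → ℕ → Set
Fits bs p = capacity (margins p) bs < middle (suc p)

-- With p = 5 + m: from p to p + 2, each value grows by at most the factor by which `middle (p + 1)`
-- grows, because p - k lies below p + 1 and `middle-growth` applies.
value-growth : ∀ m b → value (margins (7 + m)) b * middle (6 + m) ≤ value (margins (5 + m)) b * middle (8 + m)
value-growth m none   = z≤n
value-growth m single = *-monoʳ-≤ 1 (middle-mono (m≤n+m (6 + m) 2))
value-growth m (slack k) = ≤-trans (growth k) (≤-reflexive (*-comm (middle (8 + m)) _))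
  where
  growth : ∀ k → lookup (margins (7 + m)) k * middle (6 + m) ≤ middle (8 + m) * lookup (margins (5 + m)) k
  growth 0F = middle-growth (m≤n+m (5 + m) 1)
  growth 1F = middle-growth (m≤n+m (4 + m) 2)
  growth 2F = middle-growth (m≤n+m (3 + m) 3)
  growth 3F = middle-growth (m≤n+m (2 + m) 4)

capacity-growth : ∀ m bs → capacity (margins (7 + m)) bs * middle (6 + m) ≤ capacity (margins (5 + m)) bs * middle (8 + m)
capacity-growth m []       = z≤n
capacity-growth m (b ∷ bs) = begin
  (v′ + c′) * middle (6 + m)               ≡⟨ *-distribʳ-+ (middle (6 + m)) v′ c′ ⟩
  v′ * middle (6 + m) + c′ * middle (6 + m) ≤⟨ +-mono-≤ (value-growth m b) (capacity-growth m bs) ⟩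
  v * middle (8 + m) + c * middle (8 + m)   ≡⟨ sym (*-distribʳ-+ (middle (8 + m)) v c) ⟩
  (v + c) * middle (8 + m)                  ∎
  where
  open ≤-Reasoning
  v′ = value (margins (7 + m)) b
  c′ = capacity (margins (7 + m)) bs
  v  = value (margins (5 + m)) b
  c  = capacity (margins (5 + m)) bs

fits-step : ∀ bs m → Fits bs (5 + m) → Fits bs (7 + m)
fits-step bs m fits = *-cancelʳ-< (middle (6 + m)) _ _ (begin-strict
  capacity (margins (7 + m)) bs * middle (6 + m) ≤⟨ capacity-growth m bs ⟩
  capacity (margins (5 + m)) bs * middle (8 + m) <⟨ *-monoˡ-< (middle (8 + m)) ⦃ >-nonZero (middle>0 (8 + m)) ⦄ fits ⟩
  middle (6 + m) * middle (8 + m)                ≡⟨ *-comm (middle (6 + m)) _ ⟩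
  middle (8 + m) * middle (6 + m)                ∎)
  where open ≤-Reasoning

<ᵇ-true : ∀ a b → (a <ᵇ b) ≡ true → a < b
<ᵇ-true a b eq = <ᵇ⇒< a b (Equivalence.from T-≡ eq)

small⇒fits : ∀ bs → small bs ≡ true → ∀ m → Fits bs (5 + m)
small⇒fits bs eq 0 = <ᵇ-true (capacity (margins 5) bs) 20 (∧-conicalˡ _ _ eq)
small⇒fits bs eq 1 = <ᵇ-true (capacity (margins 6) bs) 35 (∧-conicalʳ (capacity (10 ∷ 6 ∷ 3 ∷ 2 ∷ []) bs <ᵇ 20) _ eq)
-- Steps of two: p = 5 starts the odd values and p = 6 the even ones.
small⇒fits bs eq (suc (suc m)) = fits-step bs m (small⇒fits bs eq m)

-- Evaluation of the check on all 3⁸ = 6561 vectors of capped multiplicities.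
all-acceptable : forall≤2 8 (λ v → acceptable (table v)) ≡ true
all-acceptable = refl

-- Counting by value in Side

_≟ˢ_ : DecidableEquality Side
_≟ˢ_ = ≡-dec Bool._≟_

satisfying : (X → Side) → (Side → Bool) → List X → List X
satisfying f P = filter (λ x → P (f x) Bool.≟ true)

ofSide : (X → Side) → Side → List X → List X
ofSide f A = filter (λ x → f x ≟ˢ A)

δ : Side → Side → ℕ
δ A B = ⟦ does (A ≟ˢ B) ⟧

length-ofSide-∷ : ∀ (f : X → Side) x xs A → length (ofSide f A (x ∷ xs)) ≡ δ (f x) A + length (ofSide f A xs)
length-ofSide-∷ f x xs A with does (f x ≟ˢ A)
... | true  = refl
... | false = refl

length-satisfying-∷ : ∀ (f : X → Side) P x xs →
  length (satisfying f P (x ∷ xs)) ≡ ⟦ P (f x) ⟧ + length (satisfying f P xs)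
length-satisfying-∷ f P x xs with P (f x)
... | true  = refl
... | false = refl

total-cong : ∀ {u w} P → (∀ A → u A ≡ w A) → total u P ≡ total w P
total-cong {u} {w} P u≗w = go sides
  where
  go : ∀ As → sum (map (λ A → u A * ⟦ P A ⟧) As) ≡ sum (map (λ A → w A * ⟦ P A ⟧) As)
  go []       = refl
  go (A ∷ As) = cong₂ _+_ (cong (_* ⟦ P A ⟧) (u≗w A)) (go As)

total-+ : ∀ u w P → total (λ A → u A + w A) P ≡ total u P + total w P
total-+ u w P = go sides
  where
  shuffle : ∀ a b c x y → (a + b) * c + (x + y) ≡ (a * c + x) + (b * c + y)
  shuffle = solve-∀
  go : ∀ As → sum (map (λ A → (u A + w A) * ⟦ P A ⟧) As)
            ≡ sum (map (λ A → u A * ⟦ P A ⟧) As) + sum (map (λ A → w A * ⟦ P A ⟧) As)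
  go []       = refl
  go (A ∷ As) = trans (cong ((u A + w A) * ⟦ P A ⟧ +_) (go As)) (shuffle (u A) (w A) ⟦ P A ⟧ _ _)

total-δ : ∀ A P → total (δ A) P ≡ ⟦ P A ⟧
total-δ A@(false ∷ false ∷ false ∷ []) P = trans (+-identityʳ _) (+-identityʳ ⟦ P A ⟧)
total-δ A@(false ∷ false ∷ true  ∷ []) P = trans (+-identityʳ _) (+-identityʳ ⟦ P A ⟧)
total-δ A@(false ∷ true  ∷ false ∷ []) P = trans (+-identityʳ _) (+-identityʳ ⟦ P A ⟧)
total-δ A@(false ∷ true  ∷ true  ∷ []) P = trans (+-identityʳ _) (+-identityʳ ⟦ P A ⟧)
total-δ A@(true  ∷ false ∷ false ∷ []) P = trans (+-identityʳ _) (+-identityʳ ⟦ P A ⟧)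
total-δ A@(true  ∷ false ∷ true  ∷ []) P = trans (+-identityʳ _) (+-identityʳ ⟦ P A ⟧)
total-δ A@(true  ∷ true  ∷ false ∷ []) P = trans (+-identityʳ _) (+-identityʳ ⟦ P A ⟧)
total-δ A@(true  ∷ true  ∷ true  ∷ []) P = trans (+-identityʳ _) (+-identityʳ ⟦ P A ⟧)

-- Each entry contributes to exactly one of the eight multiplicities; hence counts over y depend on
-- `α` only through these.
total-ofSide : ∀ (f : X → Side) P xs → total (λ A → length (ofSide f A xs)) P ≡ length (satisfying f P xs)
total-ofSide f P []       = refl
total-ofSide f P (x ∷ xs) = begin
  total (λ A → length (ofSide f A (x ∷ xs))) P            ≡⟨ total-cong P (length-ofSide-∷ f x xs) ⟩
  total (λ A → δ (f x) A + length (ofSide f A xs)) P      ≡⟨ total-+ (δ (f x)) (λ A → length (ofSide f A xs)) P ⟩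
  total (δ (f x)) P + total (λ A → length (ofSide f A xs)) P ≡⟨ cong₂ _+_ (total-δ (f x) P) (total-ofSide f P xs) ⟩
  ⟦ P (f x) ⟧ + length (satisfying f P xs)                ≡⟨ sym (length-satisfying-∷ f P x xs) ⟩
  length (satisfying f P (x ∷ xs))                        ∎
  where open ≡-Reasoning

length-satisfying-not : ∀ (f : X → Side) P xs →
  length (satisfying f P xs) + length (satisfying f (not ∘ P) xs) ≡ length xs
length-satisfying-not f P [] = refl
length-satisfying-not f P (x ∷ xs) with P (f x)
... | true  = cong suc (length-satisfying-not f P xs)
... | false = trans (+-suc _ _) (cong suc (length-satisfying-not f P xs))

length≤total : ∀ (f : X → Side) (w : Side → ℕ) xs → (∀ A → length (ofSide f A xs) ≤ w A) → length xs ≤ sum (map w sides)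
length≤total f w xs bounded = begin
  length xs ≡⟨ cong length (sym (filter-all _ (All.universal (λ _ → refl) xs))) ⟩
  length (satisfying f (λ _ → true) xs) ≡⟨ sym (total-ofSide f (λ _ → true) xs) ⟩
  total (λ A → length (ofSide f A xs)) (λ _ → true) ≤⟨ go sides ⟩
  sum (map w sides) ∎
  where
  open ≤-Reasoning
  go : ∀ As → sum (map (λ A → length (ofSide f A xs) * 1) As) ≤ sum (map w As)
  go []       = z≤n
  go (A ∷ As) = +-mono-≤ (≤-trans (≤-reflexive (*-identityʳ _)) (bounded A)) (go As)

module _ (w ℓ : Side → ℕ) (capped : ∀ A → ℓ A ≡ w A ⊓ 2) (P : Side → Bool) where

  total-capped-≤ : total ℓ P ≤ total w P
  total-capped-≤ = go sides
    where
    go : ∀ As → sum (map (λ A → ℓ A * ⟦ P A ⟧) As) ≤ sum (map (λ A → w A * ⟦ P A ⟧) As)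
    go []       = z≤n
    go (A ∷ As) = +-mono-≤ (*-monoˡ-≤ ⟦ P A ⟧ (≤-trans (≤-reflexive (capped A)) (m⊓n≤m (w A) 2))) (go As)

  -- Together with `total-capped-≤`: capping leaves totals of 0 and 1 exact, as the tests for
  -- absence and uniqueness require, and keeps larger totals at two or more.
  total-capped-≥ : total w P ⊓ 2 ≤ total ℓ P
  total-capped-≥ = go sides
    where
    ⊓-subadditive : ∀ a b → (a + b) ⊓ 2 ≤ a ⊓ 2 + b ⊓ 2
    ⊓-subadditive 0 b = ≤-refl
    ⊓-subadditive 1 0 = ≤-refl
    ⊓-subadditive 1 (suc b) = s≤s (s≤s (⊓-monoʳ-≤ b z≤n))
    ⊓-subadditive (suc (suc a)) b = s≤s (s≤s (≤-trans (m⊓n≤n (a + b) 0) z≤n))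
    *⟦⟧ : ∀ m b → (m * ⟦ b ⟧) ⊓ 2 ≡ (m ⊓ 2) * ⟦ b ⟧
    *⟦⟧ m true  = trans (cong (_⊓ 2) (*-identityʳ m)) (sym (*-identityʳ (m ⊓ 2)))
    *⟦⟧ m false = trans (cong (_⊓ 2) (*-zeroʳ m)) (sym (*-zeroʳ (m ⊓ 2)))
    go : ∀ As → sum (map (λ A → w A * ⟦ P A ⟧) As) ⊓ 2 ≤ sum (map (λ A → ℓ A * ⟦ P A ⟧) As)
    go []       = z≤n
    go (A ∷ As) = ≤-trans (⊓-subadditive (w A * ⟦ P A ⟧) _)
      (+-mono-≤ (≤-reflexive (trans (*⟦⟧ (w A) (P A)) (cong (_* ⟦ P A ⟧) (sym (capped A))))) (go As))

⊓2≤1⇒≤ : ∀ {m k} → m ⊓ 2 ≤ k → k ≤ 1 → m ≤ k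
⊓2≤1⇒≤ {0} _ _ = z≤n
⊓2≤1⇒≤ {1} p _ = p
⊓2≤1⇒≤ {suc (suc m)} p q = contradiction (≤-trans p q) λ { (s≤s ()) }

member-of-≤1 : ∀ {xs : List X} → length xs ≤ 1 → ∀ {x y} → x ∈ xs → y ∈ xs → x ≡ y
member-of-≤1 {xs = _ ∷ []} _ (here refl) (here refl) = refl
member-of-≤1 {xs = _ ∷ _ ∷ _} (s≤s ()) _ _

member-of-≤0 : ∀ {xs : List X} → length xs ≤ 0 → ∀ {x} → ¬ x ∈ xs
member-of-≤0 {xs = []} _ ()

≡ᵇ-true : ∀ m n → (m ≡ᵇ n) ≡ true → m ≡ n
≡ᵇ-true m n eq = ≡ᵇ⇒≡ m n (Equivalence.from T-≡ eq)

≤ᵇ-true : ∀ m n → (m ≤ᵇ n) ≡ true → m ≤ n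
≤ᵇ-true m n eq = ≤ᵇ⇒≤ m n (Equivalence.from T-≡ eq)

cap≤ : ∀ m → toℕ (cap m) ≤ m
cap≤ 0 = z≤n
cap≤ 1 = ≤-refl
cap≤ 2 = ≤-refl
cap≤ (suc (suc (suc m))) = s≤s (s≤s (s≤s z≤n))

lookup-margins : ∀ p k → lookup (margins p) k ≡ middle (p ∸ toℕ k)
lookup-margins p 0F = refl
lookup-margins p 1F = refl
lookup-margins p 2F = refl
lookup-margins p 3F = refl

-- The two bounds

module Configuration
  {p q : ℕ} (σ : Fin q → Side) (α : Fin p → Side) (τ : Fin q → Fin p → Bool)
  -- The common value true is the triangle v → xᵢ → y → v, and false is its reverse.
  (triangle-vy : ∀ v y → ∃ λ i → lookup (σ v) i ≡ lookup (α y) i × lookup (α y) i ≡ not (τ v y))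
  (triangle-vi : ∀ v i → ∃ λ y → lookup (σ v) i ≡ lookup (α y) i × lookup (α y) i ≡ not (τ v y))
  (antichain : ∀ {u v} → u ≢ v → ¬ ((∀ i → lookup (σ u) i ≤ᴮ lookup (σ v) i) × (∀ y → τ u y ≤ᴮ τ v y)))
  where

  strict-bound : ∀ i → (∀ j → j ≢ i → ∀ y y′ → lookup (α y) j ≡ lookup (α y′) j) → q < middle (suc p)
  strict-bound i const = subst (λ n → q < middle n) length-positions
    (sperner-strict (λ v → restrict (g v) positions) incomparable avoids)
    where
    at : Side → Bool
    at A = not (lookup A i)
    -- The missed maximal chain passes through {y ∣ i ∈ α y} and {y ∣ i ∈ α y} ∪ {i}; in this
    -- enumeration (nothing stands for i) it consists of the staircases.
    before after : List (Maybe (Fin p))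
    before = map just (satisfying α at (allFin p))
    after  = map just (satisfying α (not ∘ at) (allFin p))
    positions : List (Maybe (Fin p))
    positions = before ++ nothing ∷ after
    g : Fin q → Maybe (Fin p) → Bool
    g v nothing  = lookup (σ v) i
    g v (just y) = τ v y
    length-positions : length positions ≡ suc p
    length-positions = trans (length-++ before) (trans (+-suc _ _) (cong suc
      (trans (cong₂ _+_ (length-map just (satisfying α at (allFin p))) (length-map just (satisfying α (not ∘ at) (allFin p))))
      (trans (length-satisfying-not α at (allFin p)) (length-tabulate {n = p} (λ x → x))))))
    ∈-before : ∀ {y} → lookup (α y) i ≡ false → just y ∈ before
    ∈-before {y} eq = ∈-map⁺ just (∈-filter⁺ _ (∈-allFin y) (cong not eq))
    ∈-after : ∀ {y} → lookup (α y) i ≡ true → just y ∈ after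
    ∈-after {y} eq = ∈-map⁺ just (∈-filter⁺ _ (∈-allFin y) (cong (not ∘ not) eq))
    just∈ : ∀ y → just y ∈ positions
    just∈ y with lookup (α y) i in eq
    ... | false = ∈-++⁺ˡ (∈-before eq)
    ... | true  = ∈-++⁺ʳ before (there (∈-after eq))
    ≤-at : ∀ u v → g u nothing ≤ᴮ g v nothing → ∀ j → lookup (σ u) j ≤ᴮ lookup (σ v) j
    ≤-at u v p j with j Fin.≟ i
    ... | yes refl = p
    ... | no  j≢i with triangle-vi u j | triangle-vi v j
    -- Off i, the triangle on (v, xⱼ) makes `σ v` take the common value of the `α y` at j.
    ... | y , eq , _ | y′ , eq′ , _ = Boolₚ.≤-reflexive (trans eq (trans (const j j≢i y y′) (sym eq′)))
    incomparable : ∀ u v → u ≢ v → ¬ restrict (g u) positions ⊑ restrict (g v) positions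
    incomparable u v u≢v p = antichain u≢v
      ( ≤-at u v (restrict-⊑⁻ positions p (∈-++⁺ʳ before (here refl)))
      , λ y → restrict-⊑⁻ positions p (just∈ y))
    absurd : ∀ {a b} → a ≡ true → b ≡ false → ¬ a ≤ᴮ b
    absurd refl refl ()
    -- A triangle on (v, xᵢ) puts a true before a false: at `nothing` and a later y, or at an
    -- earlier y and `nothing`.
    avoids : ∀ v → ¬ Staircase (restrict (g v) positions)
    avoids v stairs with triangle-vi v i
    ... | y , eq , eq′ with lookup (α y) i in here-eq
    ... | true  = absurd eq (not-injective (sym eq′)) (staircase-after before stairs (∈-after here-eq))
    ... | false = absurd (not-injective (sym eq′)) eq (staircase-before before stairs (∈-before here-eq))

  weight : Side → ℕ
  weight A = length (ofSide α A (allFin p))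

  levels : Vec ℕ 8
  levels = Vec.map (λ A → weight A ⊓ 2) (fromList sides)

  -- Written through `table`, so that `all-acceptable` applies to it directly.
  ℓ : Side → ℕ
  ℓ = table levels

  ℓ-capped : ∀ A → ℓ A ≡ weight A ⊓ 2
  ℓ-capped (false ∷ false ∷ false ∷ []) = refl
  ℓ-capped (false ∷ false ∷ true  ∷ []) = refl
  ℓ-capped (false ∷ true  ∷ false ∷ []) = refl
  ℓ-capped (false ∷ true  ∷ true  ∷ []) = refl
  ℓ-capped (true  ∷ false ∷ false ∷ []) = refl
  ℓ-capped (true  ∷ false ∷ true  ∷ []) = refl
  ℓ-capped (true  ∷ true  ∷ false ∷ []) = refl
  ℓ-capped (true  ∷ true  ∷ true  ∷ []) = refl

  ys : (Side → Bool) → List (Fin p)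
  ys P = satisfying α P (allFin p)

  ∈-ys : ∀ P {y} → P (α y) ≡ true → y ∈ ys P
  ∈-ys P {y} eq = ∈-filter⁺ _ (∈-allFin y) eq

  ∈-ys⁻ : ∀ P {y} → y ∈ ys P → P (α y) ≡ true
  ∈-ys⁻ P y∈ = proj₂ (∈-filter⁻ _ {xs = allFin p} y∈)

  total-ℓ≤ : ∀ P → total ℓ P ≤ length (ys P)
  total-ℓ≤ P = ≤-trans (total-capped-≤ weight ℓ ℓ-capped P) (≤-reflexive (total-ofSide α P (allFin p)))

  length-ys≤ : ∀ P {k} → total ℓ P ≤ k → k ≤ 1 → length (ys P) ≤ k
  length-ys≤ P le = ⊓2≤1⇒≤ (≤-trans (≤-reflexive (cong (_⊓ 2) (sym (total-ofSide α P (allFin p)))))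
    (≤-trans (total-capped-≥ weight ℓ ℓ-capped P) le))

  total≡0⇒ : ∀ P → total ℓ P ≡ 0 → ∀ y → P (α y) ≡ false
  total≡0⇒ P eq y with P (α y) in Py
  ... | false = refl
  ... | true  = contradiction (∈-ys P Py) (member-of-≤0 (length-ys≤ P (≤-reflexive eq) z≤n))

  constant⇒ : ∀ i → constant ℓ i ≡ true → ∀ y y′ → lookup (α y) i ≡ lookup (α y′) i
  constant⇒ i eq y y′ with ∨-true⁻ (total ℓ (λ A → lookup A i) ≡ᵇ 0) eq
  ... | inj₁ e = trans (lem y) (sym (lem y′))
    where lem = total≡0⇒ (λ A → lookup A i) (≡ᵇ-true _ 0 e)
  ... | inj₂ e = not-injective (trans (lem y) (sym (lem y′)))
    where lem = total≡0⇒ (λ A → not (lookup A i)) (≡ᵇ-true _ 0 e)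

  special⇒ : special ℓ ≡ true → q < middle (suc p)
  special⇒ eq with ∨-true⁻ (constant ℓ 0F ∧ constant ℓ 1F) eq
  ... | inj₁ c = strict-bound 2F λ
    { 0F _ → constant⇒ 0F (∧-conicalˡ _ _ c)
    ; 1F _ → constant⇒ 1F (∧-conicalʳ (constant ℓ 0F) _ c)
    ; 2F 2≢2 → contradiction refl 2≢2 }
  ... | inj₂ eq′ with ∨-true⁻ (constant ℓ 0F ∧ constant ℓ 2F) eq′
  ... | inj₁ c = strict-bound 1F λ
    { 0F _ → constant⇒ 0F (∧-conicalˡ _ _ c)
    ; 1F 1≢1 → contradiction refl 1≢1
    ; 2F _ → constant⇒ 2F (∧-conicalʳ (constant ℓ 0F) _ c) }
  ... | inj₂ c = strict-bound 0F λ
    { 0F 0≢0 → contradiction refl 0≢0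
    ; 1F _ → constant⇒ 1F (∧-conicalˡ _ _ c)
    ; 2F _ → constant⇒ 2F (∧-conicalʳ (constant ℓ 1F) _ c) }

  module _ (S : Side) where

    cs : Vec ℕ 3
    cs = candidates ℓ S

    lookup-cs : ∀ i → lookup cs i ≡ total ℓ (agreeAt i S)
    lookup-cs 0F = refl
    lookup-cs 1F = refl
    lookup-cs 2F = refl

    vs : List (Fin q)
    vs = ofSide σ S (allFin q)

    ∈-vs⁻ : ∀ {v} → v ∈ vs → σ v ≡ S
    ∈-vs⁻ v∈ = proj₂ (∈-filter⁻ _ {xs = allFin q} v∈)

    -- The triangle on (v, y) needs a coordinate where S and `α y` agree.
    opposite-absent : ∀ {v} → σ v ≡ S → (total ℓ (opposite S) ≡ᵇ 0) ≢ false
    opposite-absent {v} refl eq with total ℓ (opposite S) | total-ℓ≤ (opposite S)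
    ... | suc _ | le with ys (opposite S) | ∈-ys⁻ (opposite S)
    ... | y ∷ _ | ∈⁻ with triangle-vy v y
    ... | i , e , _ = contradiction (trans (sym (∈⁻ (here refl))) (cong not (some⁺ (λ j → agreeAt j S (α y)) i (agree⁺ e)))) λ ()

    candidates-present : ∀ {v} → σ v ≡ S → some (λ i → lookup cs i ≡ᵇ 0) ≢ true
    candidates-present {v} refl eq with some⁻ (λ i → lookup cs i ≡ᵇ 0) eq
    ... | i , e with triangle-vi v i
    ... | y , e′ , _ = contradiction
      (trans (sym (total≡0⇒ (agreeAt i S) (trans (sym (lookup-cs i)) (≡ᵇ-true _ 0 e)) y)) (agree⁺ e′)) λ ()

    mixed⁺ : ∀ {A i j} → lookup S i ≡ lookup A i → lookup A i ≡ true →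
      lookup S j ≡ lookup A j → lookup A j ≡ false → mixed S A ≡ true
    mixed⁺ {A} {i} {j} e t e′ f = cong₂ _∧_
      (some⁺ (λ k → lookup S k ∧ lookup A k) i (cong₂ _∧_ (trans e t) t))
      (some⁺ (λ k → not (lookup S k) ∧ not (lookup A k)) j (cong₂ (λ a b → not a ∧ not b) (trans e′ f) f))

    -- If `τ u y` and `τ v y` differed, one triangle would pass through a common member of S and
    -- `α y` and the other through a common non-member.
    unmixed-fixed : ∀ {u v} → σ u ≡ S → σ v ≡ S → ∀ y → mixed S (α y) ≡ false → τ u y ≡ τ v y
    unmixed-fixed {u} {v} refl σv≡S y eq with triangle-vy u y | triangle-vy v y
    ... | i , e , f | j , e′ , f′ with τ u y | τ v y
    ... | true  | true  = refl
    ... | false | false = refl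
    ... | true  | false = contradiction (trans (sym eq) (mixed⁺ {α y} (trans (cong (λ A → lookup A j) (sym σv≡S)) e′) f′ e f)) λ ()
    ... | false | true  = contradiction (trans (sym eq) (mixed⁺ {α y} e f (trans (cong (λ A → lookup A j) (sym σv≡S)) e′) f′)) λ ()

    pinned-value : ∀ {v} → σ v ≡ S → ∀ y i → lookup cs i ≡ 1 → agreeAt i S (α y) ≡ true → not (τ v y) ≡ lookup S i
    pinned-value {v} refl y i unique here-agrees with triangle-vi v i
    ... | y′ , e , f with member-of-≤1 (length-ys≤ (agreeAt i S) (≤-reflexive (trans (sym (lookup-cs i)) unique)) ≤-refl)
                           (∈-ys (agreeAt i S) here-agrees) (∈-ys (agreeAt i S) (agree⁺ e))
    ... | refl = sym (trans e f)

    nonfree-fixed : ∀ {u v} → σ u ≡ S → σ v ≡ S → ∀ y → free ℓ S cs (α y) ≡ false → τ u y ≡ τ v y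
    nonfree-fixed σu σv y eq with mixed S (α y) in m
    ... | false = unmixed-fixed σu σv y m
    ... | true with some⁻ _ (not-injective eq)
    ... | i , e = not-injective (trans (value-at σu) (sym (value-at σv)))
      where
      value-at : ∀ {v} → σ v ≡ S → not (τ v y) ≡ lookup S i
      value-at σv = pinned-value σv y i (≡ᵇ-true _ 1 (∧-conicalˡ _ _ e)) (∧-conicalʳ (lookup cs i ≡ᵇ 1) _ e)

    -- Within the class all `σ v` coincide and the `τ v` can differ only at free y, so their
    -- restrictions to the free y are an antichain.
    length-vs≤ : length vs ≤ middle (length (ys (free ℓ S cs)))
    length-vs≤ = sperner-list vs (Unique.filter⁺ _ (Unique.allFin⁺ q)) (ys (free ℓ S cs)) τ
      λ {u} {v} u∈ v∈ u≢v le → antichain u≢v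
        ( (λ i → Boolₚ.≤-reflexive (cong (λ A → lookup A i) (trans (∈-vs⁻ u∈) (sym (∈-vs⁻ v∈)))))
        , λ y → τ-≤ u∈ v∈ y (free ℓ S cs (α y)) refl le )
      where
      τ-≤ : ∀ {u v} → u ∈ vs → v ∈ vs → ∀ y b → free ℓ S cs (α y) ≡ b →
        (∀ {y} → y ∈ ys (free ℓ S cs) → τ u y ≤ᴮ τ v y) → τ u y ≤ᴮ τ v y
      τ-≤ u∈ v∈ y true  eq le = le (∈-ys (free ℓ S cs) eq)
      τ-≤ u∈ v∈ y false eq le = Boolₚ.≤-reflexive (nonfree-fixed (∈-vs⁻ u∈) (∈-vs⁻ v∈) y eq)

    -- Both cappings can only lower the count of the y that are not free, so subtracting it from p
    -- still gives an upper bound.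
    length-free≤ : length (ys (free ℓ S cs)) ≤ p ∸ toℕ (cap (total ℓ (not ∘ free ℓ S cs)))
    length-free≤ = ≤-trans (≤-reflexive (sym (m+n∸n≡m _ (length (ys (not ∘ free ℓ S cs))))))
      (≤-trans (≤-reflexive (cong (_∸ length (ys (not ∘ free ℓ S cs)))
        (trans (length-satisfying-not α (free ℓ S cs) (allFin p)) (length-tabulate {n = p} (λ x → x)))))
      (∸-monoʳ-≤ p (≤-trans (cap≤ _) (total-ℓ≤ (not ∘ free ℓ S cs)))))

    -- Puts a member of the class at hand; for the bound `none` this member yields the
    -- contradiction.
    inhabited-bound : ∀ {k} → (∀ {v} → σ v ≡ S → length vs ≤ k) → length vs ≤ k
    inhabited-bound {k} bounded = go vs refl
      where
      go : ∀ xs → xs ≡ vs → length xs ≤ k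
      go []       _  = z≤n
      go (v ∷ xs) eq = subst (λ zs → length zs ≤ k) (sym eq) (bounded (∈-vs⁻ (subst (v ∈_) eq (here refl))))

    bound-valid : length vs ≤ value (margins p) (bound ℓ S)
    bound-valid with total ℓ (opposite S) ≡ᵇ 0 in opp
    ... | false = inhabited-bound λ σv → contradiction opp (opposite-absent σv)
    ... | true with some (λ i → lookup cs i ≡ᵇ 0) in cand
    ... | true = inhabited-bound λ σv → contradiction cand (candidates-present σv)
    ... | false with total ℓ (free ℓ S cs) ≤ᵇ 1 in few
    -- The bound 1 arises as `middle 1`.
    ... | true  = ≤-trans length-vs≤ (middle-mono (length-ys≤ (free ℓ S cs) (≤ᵇ-true _ 1 few) ≤-refl))
    ... | false = ≤-trans length-vs≤ (≤-trans (middle-mono length-free≤) (≤-reflexive (sym (lookup-margins p (cap (total ℓ (not ∘ free ℓ S cs)))))))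

  general-bound : q ≤ capacity (margins p) (map (bound ℓ) sides)
  general-bound = ≤-trans (≤-reflexive (sym (length-tabulate {n = q} (λ x → x))))
    (length≤total σ (λ S → value (margins p) (bound ℓ S)) (allFin q) bound-valid)

  levels≤2 : VAll.All (_≤ 2) levels
  levels≤2 = go (fromList sides)
    where
    go : ∀ {n} (As : Vec Side n) → VAll.All (_≤ 2) (Vec.map (λ A → weight A ⊓ 2) As)
    go []       = []
    go (A ∷ As) = m⊓n≤n (weight A) 2 ∷ go As

  bound-q : 5 ≤ p → q < middle (suc p)
  bound-q 5≤p with ∨-true⁻ (special ℓ) (forall≤2⁻ (λ v → acceptable (table v)) all-acceptable levels levels≤2)
  ... | inj₁ eq = special⇒ eq
  ... | inj₂ eq = ≤-<-trans general-bound
    (subst (Fits (map (bound ℓ) sides)) (m+[n∸m]≡n 5≤p) (small⇒fits (map (bound ℓ) sides) eq (p ∸ 5)))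

-- Orientations

n/2≡⌊n/2⌋ : ∀ n → n / 2 ≡ ⌊ n /2⌋
n/2≡⌊n/2⌋ zero          = refl
n/2≡⌊n/2⌋ (suc zero)    = refl
n/2≡⌊n/2⌋ (suc (suc n)) = trans (+-distrib-/-∣ˡ n (∣-refl {2})) (cong suc (n/2≡⌊n/2⌋ n))

module _ {p q : ℕ} (o : Orientation 3 p q) (diam2 : StrongDiam2 o) where

  pattern inX i = inj₁ i
  pattern inY y = inj₂ (inj₁ y)
  pattern inZ v = inj₂ (inj₂ v)

  reverse-arc : ∀ u v → Adj u v → arc o u v ≡ not (arc o v u)
  reverse-arc u v adj with one-dir o u v adj
  ... | inj₁ (e , e′) = trans e (cong not (sym e′))
  ... | inj₂ (e , e′) = trans e (cong not (sym e′))

  arc-asym : ∀ u v → arc o u v ≡ true → arc o v u ≡ false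
  arc-asym u v e = trans (reverse-arc v u (λ eq → arc-adj o u v e (sym eq))) (cong not e)

  σ : Fin q → Side
  σ v = Vec.tabulate λ i → arc o (inZ v) (inX i)

  α : Fin p → Side
  α y = Vec.tabulate λ i → arc o (inX i) (inY y)

  τ : Fin q → Fin p → Bool
  τ v y = arc o (inZ v) (inY y)

  lookup-σ : ∀ v i → lookup (σ v) i ≡ arc o (inZ v) (inX i)
  lookup-σ v = lookup∘tabulate (λ i → arc o (inZ v) (inX i))

  lookup-α : ∀ y i → lookup (α y) i ≡ arc o (inX i) (inY y)
  lookup-α y = lookup∘tabulate (λ i → arc o (inX i) (inY y))

  two-step : ∀ u v → u ≢ v → arc o u v ≡ false → ∃ λ w → arc o u w ≡ true × arc o w v ≡ true
  two-step u v u≢v e with diam2 u v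
  ... | inj₁ u≡v          = contradiction u≡v u≢v
  ... | inj₂ (inj₁ e′)    = contradiction (trans (sym e) e′) λ ()
  ... | inj₂ (inj₂ via)   = via

  Triangle : Fin 3 → Fin p → Fin q → Set
  Triangle i y v = lookup (σ v) i ≡ lookup (α y) i × lookup (α y) i ≡ not (τ v y)

  triangle : ∀ {i y v b} → arc o (inZ v) (inX i) ≡ b → arc o (inX i) (inY y) ≡ b → τ v y ≡ not b → Triangle i y v
  triangle {i} {y} {v} {b} e f g =
      trans (lookup-σ v i) (trans e (sym (trans (lookup-α y i) f)))
    , trans (lookup-α y i) (trans f (sym (trans (cong not g) (not-involutive b))))

  -- Against the direction of the arc between v and y there is a path of length two. Its inner
  -- vertex is adjacent to both ends, hence some xᵢ, and the path closes to a directed triangle.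
  triangle-vy : ∀ v y → ∃ λ i → Triangle i y v
  triangle-vy v y = at (τ v y) refl
    where
    at : ∀ b → τ v y ≡ b → ∃ λ i → Triangle i y v
    at false e with two-step (inZ v) (inY y) (λ ()) e
    ... | inX i , f , g = i , triangle f g e
    ... | inY _ , _ , g = contradiction refl (arc-adj o _ _ g)
    ... | inZ _ , f , _ = contradiction refl (arc-adj o _ _ f)
    at true e with two-step (inY y) (inZ v) (λ ()) (arc-asym (inZ v) (inY y) e)
    ... | inX i , f , g = i , triangle (arc-asym _ _ g) (arc-asym _ _ f) e
    ... | inY _ , f , _ = contradiction refl (arc-adj o _ _ f)
    ... | inZ _ , _ , g = contradiction refl (arc-adj o _ _ g)

  triangle-vi : ∀ v i → ∃ λ y → Triangle i y v
  triangle-vi v i = at (arc o (inZ v) (inX i)) refl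
    where
    at : ∀ b → arc o (inZ v) (inX i) ≡ b → ∃ λ y → Triangle i y v
    at true e with two-step (inX i) (inZ v) (λ ()) (arc-asym (inZ v) (inX i) e)
    ... | inX _ , f , _ = contradiction refl (arc-adj o _ _ f)
    ... | inY y , f , g = y , triangle e f (arc-asym _ _ g)
    ... | inZ _ , _ , g = contradiction refl (arc-adj o _ _ g)
    at false e with two-step (inZ v) (inX i) (λ ()) e
    ... | inX _ , _ , g = contradiction refl (arc-adj o _ _ g)
    ... | inY y , f , g = y , triangle e (arc-asym _ _ g) f
    ... | inZ _ , f , _ = contradiction refl (arc-adj o _ _ f)

  true≰false : ∀ {a b} → a ≡ true → b ≡ false → ¬ a ≤ᴮ b
  true≰false refl refl ()

  same-part : ∀ u v → arc o (inZ u) (inZ v) ≡ false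
  same-part u v with arc o (inZ u) (inZ v) in e
  ... | false = refl
  ... | true  = contradiction refl (arc-adj o _ _ e)

  -- Being non-adjacent, u and v are joined by a path u → w → v, and then w is an out-neighbour of u
  -- but not of v.
  antichain : ∀ {u v} → u ≢ v → ¬ ((∀ i → lookup (σ u) i ≤ᴮ lookup (σ v) i) × (∀ y → τ u y ≤ᴮ τ v y))
  antichain {u} {v} u≢v (σ≤ , τ≤)
    with two-step (inZ u) (inZ v) (u≢v ∘ inj₂-injective ∘ inj₂-injective) (same-part u v)
  ... | inX i , f , g = true≰false (trans (lookup-σ u i) f) (trans (lookup-σ v i) (arc-asym _ _ g)) (σ≤ i)
  ... | inY y , f , g = true≰false f (arc-asym _ _ g) (τ≤ y)
  ... | inZ _ , f , _ = contradiction refl (arc-adj o _ _ f)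

theorem4p24 : (p q : ℕ) → 5 ≤ p → p ≤ q →
  Σ (Orientation 3 p q) StrongDiam2 →
  q ≤ ((p + 1) C ((p + 1) / 2)) ∸ 1
theorem4p24 p q 5≤p _ (o , diam2) = subst (λ m → q ≤ m ∸ 1) middle≡
  -- The strict bound is `suc q ≤ middle (suc p)`; subtracting one from both sides gives the claim.
  (∸-monoˡ-≤ {suc q} 1 (Configuration.bound-q (σ o diam2) (α o diam2) (τ o diam2)
    (triangle-vy o diam2) (triangle-vi o diam2) (antichain o diam2) 5≤p))
  where
  middle≡ : middle (suc p) ≡ (p + 1) C ((p + 1) / 2)
  middle≡ = trans (cong middle (+-comm 1 p)) (cong ((p + 1) C_) (sym (n/2≡⌊n/2⌋ (p + 1))))
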